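{- $$\operatorname{gr}_4(P_5:PA_{7,5})=26 .$$
   Context: All graphs are finite, simple and undirected. $K_n$ is the complete graph on $n$ vertices and $P_5$ is the path with $5$ vertices and $4$ edges. For $t\geq\omega+1$, the pineapple $PA_{t,\omega}$ is the graph of order $t$ obtained from the complete graph $K_\omega$ by attaching $t-\omega$ pendent vertices to one and the same vertex of $K_\omega$; thus $PA_{7,5}$ is $K_5$ with two pendent vertices attached to the same vertex. A $k$-edge-coloring assigns to each edge one of $k$ colors; all $k$-edge-colorings are assumed exact, i.e. each of the $k$ colors is used at least once. An edge-colored graph is rainbow if all its edges have different colors and monochromatic if all its edges have a single color. A copy of a graph means a (not necessarily induced) subgraph isomorphic to it. For non-empty graphs $G,H$ (graphs with at least one edge) and a positive integer $k$, the Gallai-Ramsey number $\operatorname{gr}_k(G:H)$ is the minimum integer $N$ with $\binom{N}{2}\geq k$ (so that $K_N$ admits a $k$-edge-coloring) such that for all $n\geq N$, every $k$-edge-coloring of $K_n$ contains either a rainbow copy of $G$ or a monochromatic copy of $H$. -}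

module Defs where

open import Data.Nat using (ℕ; suc; _<_; _≤_; _≤?_; NonZero; _≟_; _<?_)
open import Data.Nat.Properties using (1+n≢n)
open import Data.Nat.Combinatorics using (_C_)
open import Data.Fin using (Fin; toℕ)
open import Data.Fin.Properties using () renaming (_≟_ to _≟ᶠ_)
open import Data.Product using (Σ; ∃; ∃₂; _×_; _,_; proj₁)
open import Data.Sum using (_⊎_; inj₁; inj₂; swap)
open import Function.Definitions using (Injective)
open import Relation.Binary using (Rel; Symmetric; Irreflexive; Decidable)
open import Relation.Binary.PropositionalEquality using (_≡_; _≢_; refl; sym; ≢-sym)
open import Relation.Nullary.Decidable using (True; ¬?; _×-dec_; _⊎-dec_)
open import Level using (0ℓ)

record Graph (n : ℕ) : Set₁ where
  field
    Adj        : Rel (Fin n) 0ℓ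
    adj-sym    : Symmetric Adj
    adj-irrefl : Irreflexive _≡_ Adj
    adj?       : Decidable Adj

open Graph public

K : (n : ℕ) → Graph n
K n = record
  { Adj        = _≢_
  ; adj-sym    = ≢-sym
  ; adj-irrefl = λ i≡j i≢j → i≢j i≡j
  ; adj?       = λ i j → ¬? (i ≟ᶠ j)
  }

P : (n : ℕ) → Graph n
P n = record
  { Adj        = λ i j → toℕ j ≡ suc (toℕ i) ⊎ toℕ i ≡ suc (toℕ j)
  ; adj-sym    = swap
  ; adj-irrefl = λ { refl (inj₁ e) → 1+n≢n (sym e) ; refl (inj₂ e) → 1+n≢n (sym e) }
  ; adj?       = λ i j → (toℕ j ≟ suc (toℕ i)) ⊎-dec (toℕ i ≟ suc (toℕ j))
  }

-- Vertices 0, …, ω-1 form the clique; vertices ω, …, t-1 are pendent, all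
-- attached to the clique vertex 0.
PA : (t ω : ℕ) .{{_ : NonZero ω}} {_ : True (suc ω ≤? t)} → Graph t
PA t ω = record
  { Adj        = λ i j → i ≢ j × (Clique i j ⊎ (Pendent i j ⊎ Pendent j i))
  ; adj-sym    = λ where
      (i≢j , inj₁ (i<ω , j<ω)) → ≢-sym i≢j , inj₁ (j<ω , i<ω)
      (i≢j , inj₂ p)           → ≢-sym i≢j , inj₂ (swap p)
  ; adj-irrefl = λ i≡j a → proj₁ a i≡j
  ; adj?       = λ i j → ¬? (i ≟ᶠ j) ×-dec
      (((toℕ i <? ω) ×-dec (toℕ j <? ω)) ⊎-dec
       (((toℕ i ≟ 0) ×-dec (ω ≤? toℕ j)) ⊎-dec ((toℕ j ≟ 0) ×-dec (ω ≤? toℕ i))))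
  }
  where
  Clique Pendent : Rel (Fin t) 0ℓ
  Clique  i j = toℕ i < ω × toℕ j < ω
  Pendent i j = toℕ i ≡ 0 × ω ≤ toℕ j

-- Exact edge-colorings. The value of color at a non-adjacent pair carries no
-- information: every condition below looks at adjacent pairs only.
record ExactColoring {n : ℕ} (F : Graph n) (k : ℕ) : Set where
  field
    color     : Fin n → Fin n → Fin k
    color-sym : ∀ i j → color i j ≡ color j i
    exact     : ∀ a → ∃₂ λ i j → Adj F i j × color i j ≡ a

open ExactColoring public

-- A not necessarily induced copy of G in F.
record Copy {m n : ℕ} (G : Graph m) (F : Graph n) : Set where
  field
    vertex    : Fin m → Fin n
    injective : Injective _≡_ _≡_ vertex
    edge      : ∀ {u v} → Adj G u v → Adj F (vertex u) (vertex v)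

open Copy public

module _ {m n k : ℕ} {G : Graph m} {F : Graph n} (c : ExactColoring F k) where

  edgeColor : Copy G F → Fin m → Fin m → Fin k
  edgeColor f u v = color c (vertex f u) (vertex f v)

  -- Edges are unordered pairs, so {u , v} and {x , y} coincide in two ways.
  Rainbow : Copy G F → Set
  Rainbow f = ∀ {u v x y} → Adj G u v → Adj G x y →
    edgeColor f u v ≡ edgeColor f x y → (u ≡ x × v ≡ y) ⊎ (u ≡ y × v ≡ x)

  Monochromatic : Copy G F → Set
  Monochromatic f = ∃ λ a → ∀ {u v} → Adj G u v → edgeColor f u v ≡ a

IsMinimum : (ℕ → Set) → ℕ → Set
IsMinimum Q N = Q N × (∀ M → Q M → N ≤ M)

module _ {p q : ℕ} (k : ℕ) .{{_ : NonZero k}} (G : Graph p) (H : Graph q) where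

  GallaiRamseyProperty : ℕ → Set
  GallaiRamseyProperty N = k ≤ N C 2 ×
    (∀ n → N ≤ n → (c : ExactColoring (K n) k) →
      Σ (Copy G (K n)) (Rainbow c) ⊎ Σ (Copy H (K n)) (Monochromatic c))

  -- gr_k(G : H) = N, as a relation: existence of the minimum is a theorem.
  IsGallaiRamseyNumber : ℕ → Set
  IsGallaiRamseyNumber = IsMinimum GallaiRamseyProperty

{-# OPTIONS --safe #-}

-- Upper bound.  Let K_n (n ≥ 26) be colored with exactly four colors and without rainbow P₅.
-- If some vertex is incident with three colors, then up to six vertices witnessing this and the
-- fourth color force, by a finite search, all edges between the remaining vertices to have one
-- color, which gives a monochromatic K₇.  Otherwise every vertex sees at most two colors; the
-- color sets of two vertices meet, so one color d is seen by all of them, and the other three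
-- colors live on disjoint vertex classes joined by d.  A triangle of color d in one class, or
-- edges of color d in two classes, extend to a K₅ of color d, hence to a pineapple.  If neither
-- occurs, then two classes have at most 6 vertices, so the third has at least 14, and R(3,5) ≤ 14
-- yields a pineapple in the color of that class.
--
-- Lower bound.  Blocks of 13, 6 and 6 vertices joined by color 0, where the small blocks are
-- monochromatic and the block of 13 carries the Ramsey coloring for R(3,5) = 14.
module Submission where

open import Data.Nat using (ℕ)
open import Defs
open import Data.Bool.Base using (Bool; true; false; if_then_else_; not; _∧_; _∨_)
open import Data.Bool.ListAction using (all)
open import Data.Empty using (⊥)
open import Data.Fin.Base using (Fin; zero; suc; toℕ; inject₁)
open import Data.Fin using (#_)
open import Data.Fin.Patterns
open import Data.Fin.Properties as Fin
  using (_≟_; any?; all?; sequence; injective⇒≤; toℕ-injective; toℕ-inject₁)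
open import Data.List.Base
  using (List; []; _∷_; _++_; allFin; concatMap; filter; filterᵇ; length; lookup; map; take)
open import Data.List.Membership.Propositional using (_∈_; _∉_; find; lose)
open import Data.List.Membership.Propositional.Properties using (∈-allFin; ∈-filter⁺; ∈-filter⁻; ∈-lookup)
import Data.List.Membership.DecPropositional as DecMember
open import Data.List.Properties using (filter-accept; length-tabulate; length-take)
open import Data.List.Relation.Unary.All as All using (All; []; _∷_)
import Data.List.Relation.Unary.All.Properties as All
open import Data.List.Relation.Unary.AllPairs as AllPairs using (AllPairs; []; _∷_)
import Data.List.Relation.Unary.AllPairs.Properties as AllPairs
open import Data.List.Relation.Unary.Any as Any using (here; there)
import Data.List.Relation.Unary.Any.Properties as Any
open import Data.List.Relation.Unary.Unique.Propositional using (Unique)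
import Data.List.Relation.Unary.Unique.Propositional.Properties as Unique
import Data.List.Relation.Unary.Unique.DecPropositional as DecUnique
open import Data.Maybe.Base using (Maybe; just; nothing; from-just; maybe′; _>>=_)
import Data.Maybe.Effectful as Maybe
open import Data.Nat.Base
  using (zero; suc; _+_; _*_; _≤_; _<_; _<ᵇ_; _≡ᵇ_; ∣_-_∣; z≤n; s≤s; s≤s⁻¹)
open import Data.Nat.Properties hiding (_≟_; suc-injective)
import Data.Nat.Properties as ℕ
open import Data.Nat.Solver using (module +-*-Solver)
open import Algebra.Properties.CommutativeSemigroup +-commutativeSemigroup using (x∙yz≈y∙xz)
open import Data.Product using (Σ; ∃; ∃₂; _×_; _,_; proj₁; proj₂)
open import Data.Product.Properties using (≡-dec)
open import Data.Sum using (_⊎_; inj₁; inj₂; [_,_]′)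
open import Function.Base using (_∘_; id)
open import Level using (0ℓ)
open import Relation.Binary using (Rel; Symmetric; DecidableEquality)
import Relation.Binary as Binary
open import Relation.Binary.PropositionalEquality
open import Relation.Nullary using (¬_; Dec; yes; no; contradiction; does)
open import Relation.Nullary.Decidable
  using (¬?; _×-dec_; _⊎-dec_; decidable-stable; dec⇒maybe; from-yes)
open import Relation.Unary using (Pred; Decidable)

-- Counting in lists and removing elements.

-- The pigeonhole principle for two parts: in the applications `m` and `n` are thresholds, `p` and
-- `q` the sizes of the parts.
≤-split : ∀ m n {p q} → m + n ≤ suc (p + q) → m ≤ p ⊎ n ≤ q
≤-split m n {p} {q} le with m ≤? p
... | yes m≤p = inj₁ m≤p
... | no m≰p with n ≤? q
...   | yes n≤q = inj₂ n≤q
...   | no n≰q = contradiction (≤-trans (≤-reflexive (cong suc (sym (+-suc p q))))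
                   (≤-trans (+-mono-≤ (≰⇒> m≰p) (≰⇒> n≰q)) le)) 1+n≰n

module _ {A : Set} where

  length-split : {P : Pred A 0ℓ} (P? : Decidable P) (xs : List A) →
    length xs ≡ length (filter P? xs) + length (filter (¬? ∘ P?) xs)
  length-split P? []       = refl
  length-split P? (x ∷ xs) with does (P? x)
  ... | true  = cong suc (length-split P? xs)
  ... | false = trans (cong suc (length-split P? xs)) (sym (+-suc _ _))

  length-filter-∷ : {P : Pred A 0ℓ} (P? : Decidable P) (x : A) (xs : List A) →
    length (filter P? xs) ≤ length (filter P? (x ∷ xs))
  length-filter-∷ P? x xs with does (P? x)
  ... | true  = n≤1+n _
  ... | false = ≤-refl

  length-cover : {P Q S : Pred A 0ℓ} (P? : Decidable P) (Q? : Decidable Q) (S? : Decidable S) →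
    (∀ x → P x ⊎ Q x ⊎ S x) → (xs : List A) →
    length xs ≤ length (filter P? xs) + (length (filter Q? xs) + length (filter S? xs))
  length-cover P? Q? S? cover []       = z≤n
  length-cover P? Q? S? cover (x ∷ xs) with cover x
  ... | inj₁ p rewrite filter-accept P? {x} {xs} p =
    s≤s (≤-trans (length-cover P? Q? S? cover xs)
      (+-monoʳ-≤ (length (filter P? xs)) (+-mono-≤ (length-filter-∷ Q? x xs) (length-filter-∷ S? x xs))))
  ... | inj₂ (inj₁ q) rewrite filter-accept Q? {x} {xs} q =
    ≤-trans (s≤s (≤-trans (length-cover P? Q? S? cover xs)
      (+-mono-≤ (length-filter-∷ P? x xs) (+-monoʳ-≤ (length (filter Q? xs)) (length-filter-∷ S? x xs)))))
      (≤-reflexive (sym (+-suc _ _)))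
  ... | inj₂ (inj₂ s) rewrite filter-accept S? {x} {xs} s =
    ≤-trans (s≤s (≤-trans (length-cover P? Q? S? cover xs)
      (+-mono-≤ (length-filter-∷ P? x xs) (+-monoˡ-≤ (length (filter S? xs)) (length-filter-∷ Q? x xs)))))
      (≤-reflexive (trans (sym (+-suc _ _)) (cong (length (filter P? (x ∷ xs)) +_) (sym (+-suc _ _)))))

  lookup-pairs : {R : Rel A 0ℓ} → Symmetric R → ∀ {xs} → AllPairs R xs →
    ∀ i j → i ≢ j → R (lookup xs i) (lookup xs j)
  lookup-pairs R-sym (_ ∷ _)  zero    zero    i≢j = contradiction refl i≢j
  lookup-pairs R-sym (r ∷ _)  zero    (suc j) _   = All.lookup r (∈-lookup j)
  lookup-pairs R-sym (r ∷ _)  (suc i) zero    _   = R-sym (All.lookup r (∈-lookup i))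
  lookup-pairs R-sym (_ ∷ rs) (suc i) (suc j) i≢j = lookup-pairs R-sym rs i j (i≢j ∘ cong suc)

  AllPairs-tabulate : {R : Rel A 0ℓ} → ∀ {xs} → Unique xs →
    (∀ {x y} → x ∈ xs → y ∈ xs → x ≢ y → R x y) → AllPairs R xs
  AllPairs-tabulate []         f = []
  AllPairs-tabulate (x∉ ∷ xs!) f =
    All.tabulate (λ y∈ → f (here refl) (there y∈) (All.lookup x∉ y∈))
    ∷ AllPairs-tabulate xs! (λ x∈ y∈ → f (there x∈) (there y∈))

  pick₁ : {xs : List A} → 1 ≤ length xs → ∃ λ x → x ∈ xs
  pick₁ {x ∷ _} _ = x , here refl

  pick₂ : {xs : List A} → Unique xs → 2 ≤ length xs →
    ∃₂ λ x y → x ∈ xs × y ∈ xs × x ≢ y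
  pick₂ ((x≢y ∷ _) ∷ _) _ = _ , _ , here refl , there (here refl) , x≢y
  pick₂ (_ ∷ []) (s≤s ())

  ∈-take : ∀ k {xs : List A} {x} → x ∈ take k xs → x ∈ xs
  ∈-take (suc k) {_ ∷ _} (here eq)  = here eq
  ∈-take (suc k) {_ ∷ _} (there x∈) = there (∈-take k x∈)

module _ {A : Set} (_≟_ : DecidableEquality A) where

  remove : A → List A → List A
  remove x = filter (λ y → ¬? (x ≟ y))

  remove-∉ : ∀ x {xs} → x ∉ xs → remove x xs ≡ xs
  remove-∉ x {[]}     _  = refl
  remove-∉ x {y ∷ ys} x∉ with x ≟ y
  ... | yes refl = contradiction (here refl) x∉
  ... | no _     = cong (y ∷_) (remove-∉ x (x∉ ∘ there))

  length-remove : ∀ x {xs} → Unique xs → length xs ≤ suc (length (remove x xs))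
  length-remove x [] = z≤n
  length-remove x (_∷_ {y} {ys} y∉ ys!) with x ≟ y
  ... | yes refl = s≤s (≤-reflexive (cong length (sym (remove-∉ x (All.All¬⇒¬Any y∉)))))
  ... | no _     = s≤s (length-remove x ys!)

  removeAll : List A → List A → List A
  removeAll []       xs = xs
  removeAll (s ∷ ss) xs = removeAll ss (remove s xs)

  removeAll-! : ∀ ss {xs} → Unique xs → Unique (removeAll ss xs)
  removeAll-! []       xs! = xs!
  removeAll-! (s ∷ ss) xs! = removeAll-! ss (Unique.filter⁺ _ xs!)

  length-removeAll : ∀ ss {xs} → Unique xs → length xs ≤ length ss + length (removeAll ss xs)
  length-removeAll []       xs! = ≤-refl
  length-removeAll (s ∷ ss) xs! =
    ≤-trans (length-remove s xs!) (s≤s (length-removeAll ss (Unique.filter⁺ _ xs!)))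

  removeAll⁻ : ∀ ss {xs x} → x ∈ removeAll ss xs → x ∈ xs × All (_≢ x) ss
  removeAll⁻ []       x∈ = x∈ , []
  removeAll⁻ (s ∷ ss) x∈ with removeAll⁻ ss x∈
  ... | x∈′ , ≢ss with ∈-filter⁻ (λ y → ¬? (s ≟ y)) x∈′
  ...   | x∈″ , s≢x = x∈″ , s≢x ∷ ≢ss

  -- The Ramsey bound R(3,5) ≤ 14.

  module Ramsey {E : Rel A 0ℓ} (E? : Binary.Decidable E) (E-sym : Symmetric E)
    (E-irrefl : ∀ {x} → ¬ E x x) where

    I : Rel A 0ℓ
    I x y = x ≢ y × ¬ E x y

    I? : Binary.Decidable I
    I? x y = ¬? (x ≟ y) ×-dec ¬? (E? x y)

    Edge : List A → Set
    Edge xs = ∃₂ λ x y → x ∈ xs × y ∈ xs × E x y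

    Triangle : List A → Set
    Triangle xs = ∃ λ t → length t ≡ 3 × All (_∈ xs) t × AllPairs E t

    Independent : ℕ → List A → Set
    Independent m xs = ∃ λ t → length t ≡ m × All (_∈ xs) t × AllPairs I t

    edge-or-independent : ∀ {xs} → Unique xs → Edge xs ⊎ AllPairs I xs
    edge-or-independent {xs} xs! with Any.any? (λ x → Any.any? (E? x) xs) xs
    ... | yes e with find e
    ...   | x , x∈ , e′ with find e′
    ...     | y , y∈ , exy = inj₁ (x , y , x∈ , y∈ , exy)
    edge-or-independent {xs} xs! | no ¬e = inj₂ (AllPairs-tabulate xs!
      (λ x∈ y∈ x≢y → x≢y , λ exy → ¬e (lose x∈ (lose y∈ exy))))

    E-nbrs I-nbrs : A → List A → List A
    E-nbrs x = filter (E? x)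
    I-nbrs x = filter (I? x)

    -- The extra one pays for `x` itself, which may occur in `xs` but is in neither neighbourhood.
    length-nbrs : ∀ x {xs} → Unique xs →
      length xs ≤ suc (length (E-nbrs x xs) + length (I-nbrs x xs))
    length-nbrs x [] = z≤n
    length-nbrs x (_∷_ {y} {ys} y∉ ys!) with E? x y | x ≟ y
    ... | yes e | yes refl = contradiction e E-irrefl
    ... | yes _ | no _ = s≤s (length-nbrs x ys!)
    ... | no _ | no _ = s≤s (≤-trans (length-nbrs x ys!) (≤-reflexive (sym (+-suc _ _))))
    -- The extra one is spent here; since the list has no repetitions, its tail does not contain
    -- `x`.
    ... | no _ | yes refl = s≤s (only ys y∉)
      where
      only : ∀ ys → All (x ≢_) ys → length ys ≤ length (E-nbrs x ys) + length (I-nbrs x ys)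
      only [] [] = z≤n
      only (z ∷ zs) (x≢z ∷ ≢zs) with E? x z | x ≟ z
      ... | _ | yes x≡z = contradiction x≡z x≢z
      ... | yes _ | no _ = s≤s (only zs ≢zs)
      ... | no _ | no _ = ≤-trans (s≤s (only zs ≢zs)) (≤-reflexive (sym (+-suc _ _)))

    -- In the usual notation N → (3, m), that is, R(3, m) ≤ N.
    Arrows : ℕ → ℕ → Set
    Arrows N m = ∀ {xs} → Unique xs → N ≤ length xs → Triangle xs ⊎ Independent m xs

    -- An edge among the neighbours of `x` closes a triangle with `x`; without one, they are
    -- themselves independent. Among the non-neighbours, an independent set can be enlarged by `x`.
    pivot : ∀ {N m} → Arrows N m → ∀ {xs x} → Unique xs → x ∈ xs →
      suc m ≤ length (E-nbrs x xs) ⊎ N ≤ length (I-nbrs x xs) →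
      Triangle xs ⊎ Independent (suc m) xs
    pivot arr {xs} {x} xs! x∈ (inj₁ deg) with edge-or-independent (Unique.filter⁺ (E? x) xs!)
    ... | inj₁ (y , z , y∈ , z∈ , eyz) with ∈-filter⁻ (E? x) {xs = xs} y∈ | ∈-filter⁻ (E? x) {xs = xs} z∈
    ...   | y∈′ , exy | z∈′ , exz =
      inj₁ (x ∷ y ∷ z ∷ [] , refl , x∈ ∷ y∈′ ∷ z∈′ ∷ [] , (exy ∷ exz ∷ []) ∷ (eyz ∷ []) ∷ [] ∷ [])
    pivot {m = m} arr {xs} {x} xs! x∈ (inj₁ deg) | inj₂ ind =
      inj₂ (take (suc m) (E-nbrs x xs) , trans (length-take (suc m) (E-nbrs x xs)) (m≤n⇒m⊓n≡m deg)
           , All.take⁺ _ (All.tabulate (proj₁ ∘ ∈-filter⁻ (E? x))) , AllPairs.take⁺ _ ind)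
    pivot arr {xs} {x} xs! x∈ (inj₂ codeg) with arr (Unique.filter⁺ (I? x) xs!) codeg
    ... | inj₁ (t , len , t⊆ , edges) = inj₁ (t , len , All.map (proj₁ ∘ ∈-filter⁻ (I? x)) t⊆ , edges)
    ... | inj₂ (t , len , t⊆ , ind) = inj₂ (x ∷ t , cong suc len
          , x∈ ∷ All.map (proj₁ ∘ ∈-filter⁻ (I? x)) t⊆
          , All.map (proj₂ ∘ ∈-filter⁻ (I? x) {xs = xs}) t⊆ ∷ ind)

    -- R(3, m+1) ≤ R(3, m) + m + 1, because with that many vertices every vertex is a pivot.
    step : ∀ {N m} → Arrows N m → Arrows (suc m + N) (suc m)
    step {N} {m} arr {xs@(x ∷ _)} xs! le =
      pivot arr xs! (here refl) (≤-split (suc m) N (≤-trans le (length-nbrs x xs!)))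

    arrows₁ : Arrows 1 1
    arrows₁ {x ∷ _} _ _ = inj₂ (x ∷ [] , refl , here refl ∷ [] , [] ∷ [])

    arrows₃ : Arrows 6 3
    arrows₃ = step (step arrows₁)

    -- Counts ordered adjacent pairs. Keeping the two lists separate lets the induction in
    -- `handshake` extend one of them at a time.
    degrees : List A → List A → ℕ
    degrees []       ys = 0
    degrees (z ∷ zs) ys = length (E-nbrs z ys) + degrees zs ys

    degrees-∷ : ∀ x zs ys → degrees zs (x ∷ ys) ≡ length (E-nbrs x zs) + degrees zs ys
    degrees-∷ x []       ys = refl
    degrees-∷ x (z ∷ zs) ys with E? x z | E? z x | exchange
      where
      exchange : length (E-nbrs z ys) + degrees zs (x ∷ ys)
               ≡ length (E-nbrs x zs) + (length (E-nbrs z ys) + degrees zs ys)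
      exchange = trans (cong (length (E-nbrs z ys) +_) (degrees-∷ x zs ys))
        (x∙yz≈y∙xz (length (E-nbrs z ys)) (length (E-nbrs x zs)) (degrees zs ys))
    ... | yes _   | yes _   | eq = cong suc eq
    ... | no _    | no _    | eq = eq
    ... | yes exz | no ¬ezx | _  = contradiction (E-sym exz) ¬ezx
    ... | no ¬exz | yes ezx | _  = contradiction (E-sym ezx) ¬exz

    handshake : ∀ xs → ∃ λ k → degrees xs xs ≡ 2 * k
    handshake [] = 0 , refl
    handshake (x ∷ xs) with handshake xs | E? x x
    ... | _ , _   | yes e = contradiction e E-irrefl
    ... | k , eq  | no _  = length (E-nbrs x xs) + k , (begin
      length (E-nbrs x xs) + degrees xs (x ∷ xs)
        ≡⟨ cong (length (E-nbrs x xs) +_) (trans (degrees-∷ x xs xs) (cong (length (E-nbrs x xs) +_) eq)) ⟩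
      length (E-nbrs x xs) + (length (E-nbrs x xs) + 2 * k)
        ≡⟨ solve 2 (λ a b → a :+ (a :+ con 2 :* b) := con 2 :* (a :+ b)) refl (length (E-nbrs x xs)) k ⟩
      2 * (length (E-nbrs x xs) + k) ∎)
      where
      open ≡-Reasoning
      open +-*-Solver

    degrees-const : ∀ d {zs} ys → All (λ z → length (E-nbrs z ys) ≡ d) zs → degrees zs ys ≡ length zs * d
    degrees-const d ys []         = refl
    degrees-const d ys (eq ∷ eqs) = cong₂ _+_ eq (degrees-const d ys eqs)

    Pivotal : List A → A → Set
    Pivotal xs x = 4 ≤ length (E-nbrs x xs) ⊎ 6 ≤ length (I-nbrs x xs)

    Pivotal? : ∀ xs → Decidable (Pivotal xs)
    Pivotal? xs x = (4 ≤? length (E-nbrs x xs)) ⊎-dec (6 ≤? length (I-nbrs x xs))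

    -- Nine vertices without a pivot would all have degree 3, against the handshake lemma.
    pivot-exists : ∀ {xs} → Unique xs → length xs ≡ 9 → ∃ λ x → x ∈ xs × Pivotal xs x
    pivot-exists {xs} xs! len with Any.any? (Pivotal? xs) xs
    ... | yes p = find p
    -- The degree sum 27 = 9 · 3 is read as 1 + 2 · 13.
    ... | no ¬p = contradiction (trans (sym even) odd) (even≢odd k 13)
      where
      deg≡3 : ∀ {x} → x ∈ xs → length (E-nbrs x xs) ≡ 3
      -- Without a pivot there are at most 3 neighbours and at most 5 non-neighbours, and together
      -- they make up the 8 other vertices.
      deg≡3 {x} x∈ = ≤-antisym deg≤3 (+-cancelʳ-≤ 5 3 _
        (s≤s⁻¹ (≤-trans (≤-reflexive (sym len)) (≤-trans (length-nbrs x xs!)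
          (s≤s (+-monoʳ-≤ (length (E-nbrs x xs)) codeg≤5))))))
        where
        deg≤3 = s≤s⁻¹ (≰⇒> (λ 4≤ → ¬p (lose x∈ (inj₁ 4≤))))
        codeg≤5 = s≤s⁻¹ (≰⇒> (λ 6≤ → ¬p (lose x∈ (inj₂ 6≤))))
      k = proj₁ (handshake xs)
      even : degrees xs xs ≡ 2 * k
      even = proj₂ (handshake xs)
      odd : degrees xs xs ≡ 27
      odd = trans (degrees-const 3 xs (All.tabulate deg≡3)) (cong (_* 3) len)

    -- `step` would only give 10; parity saves one vertex. The list is cut to exactly nine entries
    -- because the parity argument needs an odd number of vertices.
    arrows₄ : Arrows 9 4
    arrows₄ {xs} xs! 9≤ with pivot-exists (Unique.take⁺ 9 xs!) (trans (length-take 9 xs) (m≤n⇒m⊓n≡m 9≤))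
    ... | x , x∈ , p with pivot arrows₃ (Unique.take⁺ 9 xs!) x∈ p
    ...   | inj₁ (t , len , t⊆ , edges) = inj₁ (t , len , All.map (∈-take 9) t⊆ , edges)
    ...   | inj₂ (t , len , t⊆ , ind)   = inj₂ (t , len , All.map (∈-take 9) t⊆ , ind)

    arrows₅ : Arrows 14 5
    arrows₅ = step arrows₄

-- Lists without repetitions as injections.

lookup-injective : ∀ {A : Set} {xs : List A} → Unique xs → ∀ {i j} → lookup xs i ≡ lookup xs j → i ≡ j
lookup-injective xs! {i} {j} eq = decidable-stable (i ≟ j) (λ i≢j → lookup-pairs ≢-sym xs! i j i≢j eq)

Unique-length : ∀ {n} {xs : List (Fin n)} → Unique xs → length xs ≤ n
Unique-length xs! = injective⇒≤ (lookup-injective xs!)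

Unique-full : ∀ {n} {xs : List (Fin n)} → Unique xs → length xs ≡ n → ∀ x → x ∈ xs
Unique-full {n} {xs} xs! len x = decidable-stable (DecMember._∈?_ _≟_ x xs) (λ x∉ →
  1+n≰n (subst (λ l → suc l ≤ n) len (Unique-length (All.tabulate (λ y∈ x≡y → x∉ (subst (_∈ xs) (sym x≡y) y∈)) ∷ xs!))))

lookup-surjective : ∀ {n} {xs : List (Fin n)} → Unique xs → length xs ≡ n → ∀ x → ∃ λ i → lookup xs i ≡ x
lookup-surjective xs! len x = Any.index x∈ , sym (Any.lookup-index x∈)
  where x∈ = Unique-full xs! len x

length-⊆ : {A : Set} {xs ys : List A} → Unique xs → All (_∈ ys) xs → length xs ≤ length ys
length-⊆ {xs = xs} {ys} xs! xs⊆ys = injective⇒≤ {f = position} λ {i} {j} eq → lookup-injective xs!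
  (trans (Any.lookup-index (member i)) (trans (cong (lookup ys) eq) (sym (Any.lookup-index (member j)))))
  where
  member : ∀ i → lookup xs i ∈ ys
  member i = All.lookup xs⊆ys (∈-lookup i)
  position : Fin (length xs) → Fin (length ys)
  position i = Any.index (member i)

-- For permuting the three legs of a claw: `swap₁` exchanges the first two and `swap₂` the last two.
-- Vertex lists and color lists both have one entry ahead of the legs, so the same permutation
-- serves for both.
swap₁ : {A : Set} {z a b : A} {xs : List A} → Unique (z ∷ a ∷ b ∷ xs) → Unique (z ∷ b ∷ a ∷ xs)
swap₁ ((z≢a ∷ z≢b ∷ z∉) ∷ (a≢b ∷ a∉) ∷ b∉ ∷ xs!) =
  (z≢b ∷ z≢a ∷ z∉) ∷ (≢-sym a≢b ∷ b∉) ∷ a∉ ∷ xs!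

swap₂ : {A : Set} {y z a b : A} {xs : List A} → Unique (y ∷ z ∷ a ∷ b ∷ xs) → Unique (y ∷ z ∷ b ∷ a ∷ xs)
swap₂ ((y≢z ∷ y≢a ∷ y≢b ∷ y∉) ∷ xs!) = (y≢z ∷ y≢b ∷ y≢a ∷ y∉) ∷ swap₁ xs!

fresh : ∀ {n} (ks : List (Fin n)) → length ks < n → ∃ λ l → All (l ≢_) ks
fresh {n} ks len with pick₁ {xs = removeAll _≟_ ks (allFin n)} (+-cancelˡ-≤ (length ks) 1 _
   (≤-trans (≤-reflexive (+-comm _ 1)) (≤-trans len (≤-trans (≤-reflexive (sym (length-tabulate id)))
     (length-removeAll _≟_ ks (Unique.allFin⁺ n))))))
... | l , l∈ = l , All.map ≢-sym (proj₂ (removeAll⁻ _≟_ ks l∈))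

-- A search for rainbow paths with checked results.

RainbowFree : {A : Set} → (A → A → Fin 4) → Set
RainbowFree χ = ∀ {a b c d e} → Unique (a ∷ b ∷ c ∷ d ∷ e ∷ []) →
  ¬ Unique (χ a b ∷ χ b c ∷ χ c d ∷ χ d e ∷ [])

module Search {N : ℕ} where

  -- An edge with an orientation and the label of its assumed color.
  Arc : Set
  Arc = Fin N × Fin N × Fin 4

  _≟ᵃ_ : (x y : Arc) → Dec (x ≡ y)
  _≟ᵃ_ = ≡-dec _≟_ (≡-dec _≟_ _≟_)

  open DecMember _≟ᵃ_ using (_∈?_)

  both : Arc → List Arc
  both (u , w , c) = (u , w , c) ∷ (w , u , c) ∷ []

  -- The vertices of a path and the labels of its edges, latest first.
  Trail : Set
  Trail = List (Fin N) × List (Fin 4)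

  grow : List Arc → Trail → List Trail
  grow arcs ([] , _)       = []
  grow arcs (v ∷ vs , cs) = map (λ (_ , w , c) → w ∷ v ∷ vs , c ∷ cs) (filterᵇ extends arcs)
    where
    fresh? : ∀ {k} → Fin k → List (Fin k) → Bool
    fresh? x = all (λ y → not (does (x ≟ y)))
    extends : Arc → Bool
    extends (u , w , c) = does (u ≟ v) ∧ fresh? w vs ∧ fresh? c cs

  -- Nothing is proved about this generator: conflict checks each of its outputs. New arcs occur
  -- in first or second position only, which suffices because new contains both orientations.
  candidates : List Arc → List Arc → List Trail
  candidates new arcs = concatMap (grow arcs) (concatMap (grow arcs)
    (concatMap (grow arcs) (map start new) ++ concatMap (grow new) (map start arcs)))
    where
    start : Arc → Trail
    start (u , w , c) = w ∷ u ∷ [] , c ∷ []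

  -- The label c of an arc stands for the color κ c, so that a search covers all colorings that
  -- differ by a permutation of the colors.
  module Certify (κ : Fin 4 → Fin 4) (κ-inj : ∀ {x y} → κ x ≡ κ y → x ≡ y) (κ-surj : ∀ x → ∃ λ c → κ c ≡ x)
    (f : Fin N → Fin N → Fin 4) (f-sym : ∀ i j → f i j ≡ f j i) (free : RainbowFree f) where

    Agrees : List Arc → Set
    Agrees = All (λ (u , w , c) → f u w ≡ κ c)

    agrees-both : ∀ {u w c arcs} → f u w ≡ κ c → Agrees arcs → Agrees (both (u , w , c) ++ arcs)
    agrees-both eq ag = eq ∷ trans (f-sym _ _) eq ∷ ag

    agrees-concatMap : ∀ {arcs} → Agrees arcs → Agrees (concatMap both arcs)
    agrees-concatMap []        = []
    agrees-concatMap (eq ∷ ag) = agrees-both eq (agrees-concatMap ag)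

    -- A trail that passes the checks is a rainbow path in every coloring that agrees with `arcs`:
    -- by `κ-inj`, distinct labels stand for distinct colors.
    conflict : ∀ arcs → Trail → Maybe (¬ Agrees arcs)
    conflict arcs (vs@(a ∷ b ∷ c ∷ d ∷ e ∷ []) , cs@(k ∷ l ∷ m ∷ n ∷ [])) = dec⇒maybe
      (DecUnique.unique? _≟_ vs ×-dec DecUnique.unique? _≟_ cs ×-dec
       (a , b , k) ∈? arcs ×-dec (b , c , l) ∈? arcs ×-dec (c , d , m) ∈? arcs ×-dec (d , e , n) ∈? arcs)
      >>= λ (vs! , cs! , ab , bc , cd , de) → just λ ag → free vs!
        (subst₂ (λ x y → Unique (x ∷ y ∷ _)) (sym (All.lookup ag ab)) (sym (All.lookup ag bc))
        (subst₂ (λ x y → Unique (_ ∷ _ ∷ x ∷ y ∷ [])) (sym (All.lookup ag cd)) (sym (All.lookup ag de))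
        (Unique.map⁺ κ-inj cs!)))
    conflict _ _ = nothing

    firstConflict : ∀ arcs → List Trail → Maybe (¬ Agrees arcs)
    firstConflict arcs []       = nothing
    firstConflict arcs (x ∷ xs) = maybe′ just (firstConflict arcs xs) (conflict arcs x)

    module _ (p q r : Fin N) where

      equal : ∀ arcs → Maybe (Agrees arcs → f p q ≡ f p r)
      equal arcs = dec⇒maybe (any? (λ c → (p , q , c) ∈? arcs ×-dec (p , r , c) ∈? arcs))
        >>= λ (_ , pq , pr) → just λ ag → trans (All.lookup ag pq) (sym (All.lookup ag pr))

      -- A decision tree over the colors of the listed edges. All four branches at an edge must
      -- succeed: a branch ends at a rainbow path, and if none turns up, its leaf must record the
      -- same label for both edges of the goal.
      search : List (Fin N × Fin N) → ∀ arcs → Maybe (Agrees arcs → f p q ≡ f p r)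
      search []             arcs = equal arcs
      search ((u , w) ∷ es) arcs = sequence Maybe.applicative branch >>= λ rec → just λ ag →
          let c , eq = κ-surj (f u w) in rec c (agrees-both (sym eq) ag)
        where
        branch : ∀ c → Maybe (Agrees (both (u , w , c) ++ arcs) → f p q ≡ f p r)
        branch c = let arcs′ = both (u , w , c) ++ arcs in
          -- The recursive search is the default, taken when the new edge completes no rainbow path.
          maybe′ (λ no-ag → just (λ ag → contradiction ag no-ag)) (search es arcs′)
            (firstConflict arcs′ (candidates (both (u , w , c)) arcs′))

      entails : List (Fin N × Fin N) → ∀ arcs → Maybe (Agrees arcs → f p q ≡ f p r)
      entails es arcs = search es (concatMap both arcs) >>= λ goal → just (goal ∘ agrees-concatMap)

-- Consequences of a vertex with three colors and an edge of the fourth.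

module Claws {V : Set} (_≟_ : DecidableEquality V) (χ : V → V → Fin 4)
  (χ-sym : ∀ u w → χ u w ≡ χ w u) (free : RainbowFree χ) where

  module _ (us : List V) (us! : Unique us) (k₀ k₁ k₂ k₃ : Fin 4) (ks! : Unique (k₀ ∷ k₁ ∷ k₂ ∷ k₃ ∷ []))
    where

    -- Vertices become positions in `us`, so that the search computes with numerals although the
    -- vertices are variables.
    pull : Fin (length us) → Fin (length us) → Fin 4
    pull i j = χ (lookup us i) (lookup us j)

    open Search.Certify (lookup (k₀ ∷ k₁ ∷ k₂ ∷ k₃ ∷ [])) (lookup-injective ks!)
      (lookup-surjective ks! refl) pull (λ i j → χ-sym _ _) (λ vs! → free (Unique.map⁺ (lookup-injective us!) vs!)) public

  module _ {v a b c p q r : V} where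

    -- Vertices are numbered by their position in the first hypothesis and colors by their position
    -- in the second. The order in which the edges are branched on was chosen to keep the search
    -- tree small.
    claw-ab : Unique (v ∷ a ∷ b ∷ c ∷ p ∷ q ∷ r ∷ []) → Unique (χ a b ∷ χ v a ∷ χ v b ∷ χ v c ∷ []) →
      χ p q ≡ χ p r
    claw-ab us! ks! = from-just (entails _ us! _ _ _ _ ks! 4F 5F 6F
         ((3F , 4F) ∷ (1F , 4F) ∷ (3F , 5F) ∷ (2F , 5F) ∷ (4F , 5F) ∷ (4F , 6F) ∷ (0F , 6F) ∷ (5F , 6F) ∷ [])
         ((1F , 2F , 0F) ∷ (0F , 1F , 1F) ∷ (0F , 2F , 2F) ∷ (0F , 3F , 3F) ∷ []))
         (refl ∷ refl ∷ refl ∷ refl ∷ [])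

    module _ {y : V} where

      claw-vy : Unique (y ∷ v ∷ a ∷ b ∷ c ∷ p ∷ q ∷ r ∷ []) →
        Unique (χ v y ∷ χ v a ∷ χ v b ∷ χ v c ∷ []) → χ p q ≡ χ p r
      claw-vy us! ks! = from-just (entails _ us! _ _ _ _ ks! 5F 6F 7F
         ((2F , 3F) ∷ (4F , 0F) ∷ (2F , 4F) ∷ (3F , 0F) ∷ (2F , 5F) ∷ (0F , 5F) ∷ (3F , 5F) ∷ (4F , 5F) ∷
          (2F , 6F) ∷ (2F , 7F) ∷ (3F , 6F) ∷ (3F , 7F) ∷ (5F , 6F) ∷ (5F , 7F) ∷ [])
         ((1F , 0F , 0F) ∷ (1F , 2F , 1F) ∷ (1F , 3F , 2F) ∷ (1F , 4F , 3F) ∷ []))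
         (refl ∷ refl ∷ refl ∷ refl ∷ [])

      claw-ay : Unique (y ∷ v ∷ a ∷ b ∷ c ∷ p ∷ q ∷ r ∷ []) →
        Unique (χ a y ∷ χ v a ∷ χ v b ∷ χ v c ∷ []) → χ p q ≡ χ p r
      claw-ay us! ks! = from-just (entails _ us! _ _ _ _ ks! 5F 6F 7F
         ((3F , 0F) ∷ (4F , 0F) ∷ (0F , 5F) ∷ (0F , 6F) ∷ (0F , 7F) ∷ (2F , 3F) ∷ (3F , 5F) ∷ (2F , 5F) ∷
          (4F , 5F) ∷ (5F , 6F) ∷ (5F , 7F) ∷ [])
         ((2F , 0F , 0F) ∷ (1F , 2F , 1F) ∷ (1F , 3F , 2F) ∷ (1F , 4F , 3F) ∷ []))
         (refl ∷ refl ∷ refl ∷ refl ∷ [])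

      claw-xy : ∀ {x} → Unique (x ∷ y ∷ v ∷ a ∷ b ∷ c ∷ p ∷ q ∷ r ∷ []) →
        Unique (χ x y ∷ χ v a ∷ χ v b ∷ χ v c ∷ []) → χ p q ≡ χ p r
      claw-xy us! ks! = from-just (entails _ us! _ _ _ _ ks! 6F 7F 8F
         ((3F , 0F) ∷ (4F , 0F) ∷ (5F , 0F) ∷ (3F , 4F) ∷ (3F , 1F) ∷ (4F , 1F) ∷ (5F , 1F) ∷ (0F , 6F) ∷
          (1F , 6F) ∷ (3F , 6F) ∷ (4F , 6F) ∷ (5F , 6F) ∷ (0F , 7F) ∷ (0F , 8F) ∷ (1F , 7F) ∷ (1F , 8F) ∷
          (6F , 7F) ∷ (6F , 8F) ∷ [])
         ((0F , 1F , 0F) ∷ (2F , 3F , 1F) ∷ (2F , 4F , 2F) ∷ (2F , 5F , 3F) ∷ []))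
         (refl ∷ refl ∷ refl ∷ refl ∷ [])

  module _ {p q r : V} where

    Base : V → V → V → V → Set
    Base v a b c = Unique (v ∷ a ∷ b ∷ c ∷ p ∷ q ∷ r ∷ [])

    Colors : Fin 4 → V → V → V → V → Set
    Colors k v a b c = Unique (k ∷ χ v a ∷ χ v b ∷ χ v c ∷ [])

    Outside : V → Set
    Outside y = All (y ≢_) (p ∷ q ∷ r ∷ [])

    leg : ∀ {v a b c y} → Base v a b c → Colors (χ a y) v a b c → y ≢ v → y ≢ a → Outside y → χ p q ≡ χ p r
    leg {v} {a} {b} {c} {y} base cols y≢v y≢a out with y ≟ b | y ≟ c
    ... | yes refl | _ = claw-ab base cols
    ... | no _ | yes refl = claw-ab (swap₂ base) (swap₂ cols)
    ... | no y≢b | no y≢c = claw-ay ((y≢v ∷ y≢a ∷ y≢b ∷ y≢c ∷ out) ∷ base) cols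

    legs : ∀ {v a b c x y} → Base v a b c → Colors (χ x y) v a b c → x ∈ a ∷ b ∷ c ∷ [] → y ≢ v → y ≢ x →
      Outside y → χ p q ≡ χ p r
    legs base cols (here refl) = leg base cols
    legs base cols (there (here refl)) = leg (swap₁ base) (swap₁ cols)
    legs base cols (there (there (here refl))) = leg (swap₁ (swap₂ base)) (swap₁ (swap₂ cols))

    centre : ∀ {v a b c y} → Base v a b c → Colors (χ v y) v a b c → y ≢ v → Outside y → χ p q ≡ χ p r
    centre base cols@((≢a ∷ ≢b ∷ ≢c ∷ []) ∷ _) y≢v out =
      -- `y` is not a leg, since the edge from the centre to `y` has a color different from those of
      -- the legs.
      claw-vy ((y≢v ∷ (λ { refl → ≢a refl }) ∷ (λ { refl → ≢b refl }) ∷ (λ { refl → ≢c refl }) ∷ out) ∷ base) cols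

    -- The edge of the fourth color joins two legs, or joins the centre or a leg to a new vertex, or
    -- is disjoint from the claw. Up to permuting the legs, each case is one of the four searches.
    claw-const : ∀ {v a b c x y} → Base v a b c → Colors (χ x y) v a b c → x ≢ y → Outside x → Outside y →
      χ p q ≡ χ p r
    claw-const {v} {a} {b} {c} {x} {y} base cols x≢y out-x out-y = go (x ≟ v) (y ≟ v)
      where
      open DecMember _≟_ using (_∈?_)
      cols′ : Colors (χ y x) v a b c
      cols′ = subst (λ k → Colors k v a b c) (χ-sym x y) cols
      go : Dec (x ≡ v) → Dec (y ≡ v) → χ p q ≡ χ p r
      go (yes refl) _ = centre base cols (≢-sym x≢y) out-y
      go _ (yes refl) = centre base cols′ x≢y out-x
      go (no x≢v) (no y≢v) with x ∈? (a ∷ b ∷ c ∷ []) | y ∈? (a ∷ b ∷ c ∷ [])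
      ... | yes x∈ | _ = legs base cols x∈ y≢v (≢-sym x≢y) out-y
      ... | no _ | yes y∈ = legs base cols′ y∈ x≢v x≢y out-x
      ... | no x∉ | no y∉ = claw-xy
        ((x≢y ∷ x≢v ∷ distinct x∉ out-x) ∷ (y≢v ∷ distinct y∉ out-y) ∷ base) cols
        where
        distinct : ∀ {z} → ¬ z ∈ a ∷ b ∷ c ∷ [] → Outside z → All (z ≢_) (a ∷ b ∷ c ∷ p ∷ q ∷ r ∷ [])
        distinct z∉ out = (λ e → z∉ (here e)) ∷ (λ e → z∉ (there (here e))) ∷ (λ e → z∉ (there (there (here e)))) ∷ out

-- The upper bound: recognizing rainbow paths and pineapples.

module Upper {n : ℕ} (26≤n : 26 ≤ n) (col : ExactColoring (K n) 4) where

  χ : Fin n → Fin n → Fin 4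
  χ = color col

  χ-sym : ∀ u w → χ u w ≡ χ w u
  χ-sym = color-sym col

  MonoPineapple : Set
  MonoPineapple = Σ (Copy (PA 7 5) (K n)) (Monochromatic col)

  rainbowPath : ∀ {a b c d e} → Unique (a ∷ b ∷ c ∷ d ∷ e ∷ []) →
    Unique (χ a b ∷ χ b c ∷ χ c d ∷ χ d e ∷ []) → Σ (Copy (P 5) (K n)) (Rainbow col)
  -- Edges of equal color have the same position along the path, hence agree up to orientation.
  rainbowPath {a} {b} {c} {d} {e} vs! cs! = copy , λ uv xy eq →
    let i , i≡ , uv≡ = position uv ; j , j≡ , xy≡ = position xy
    in same uv≡ xy≡ (lookup-injective cs! (trans i≡ (trans eq (sym j≡))))
    where
    vs = a ∷ b ∷ c ∷ d ∷ e ∷ []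
    cs = χ a b ∷ χ b c ∷ χ c d ∷ χ d e ∷ []

    copy : Copy (P 5) (K n)
    copy = record
      { vertex    = lookup vs
      ; injective = lookup-injective vs!
      ; edge      = λ {u} {v} uv eq → adj-irrefl (P 5) (lookup-injective vs! {u} {v} eq) uv
      }

    IsEdge : Fin 4 → Fin 5 → Fin 5 → Set
    IsEdge i u v = (u ≡ inject₁ i × v ≡ suc i) ⊎ (u ≡ suc i × v ≡ inject₁ i)

    cs-lookup : ∀ i → lookup cs i ≡ χ (lookup vs (inject₁ i)) (lookup vs (suc i))
    cs-lookup 0F = refl
    cs-lookup 1F = refl
    cs-lookup 2F = refl
    cs-lookup 3F = refl

    predecessor : ∀ {u : Fin 5} {i : Fin 4} → suc (toℕ i) ≡ suc (toℕ u) → u ≡ inject₁ i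
    predecessor {i = i} eq = toℕ-injective (trans (sym (ℕ.suc-injective eq)) (sym (toℕ-inject₁ i)))

    position : ∀ {u v} → Adj (P 5) u v → ∃ λ i → lookup cs i ≡ edgeColor col copy u v × IsEdge i u v
    position {_} {suc i} (inj₁ eq) with refl ← predecessor eq = i , cs-lookup i , inj₁ (refl , refl)
    position {suc i} {_} (inj₂ eq) with refl ← predecessor eq =
      i , trans (cs-lookup i) (χ-sym _ _) , inj₂ (refl , refl)

    same : ∀ {i j u v x y} → IsEdge i u v → IsEdge j x y → i ≡ j → (u ≡ x × v ≡ y) ⊎ (u ≡ y × v ≡ x)
    same (inj₁ (refl , refl)) (inj₁ (refl , refl)) refl = inj₁ (refl , refl)
    same (inj₁ (refl , refl)) (inj₂ (refl , refl)) refl = inj₂ (refl , refl)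
    same (inj₂ (refl , refl)) (inj₁ (refl , refl)) refl = inj₂ (refl , refl)
    same (inj₂ (refl , refl)) (inj₂ (refl , refl)) refl = inj₁ (refl , refl)

  Joined : Fin 4 → Rel (Fin n) _
  Joined k x y = x ≢ y × χ x y ≡ k

  Joined-sym : ∀ {k} → Symmetric (Joined k)
  Joined-sym (x≢y , eq) = ≢-sym x≢y , trans (χ-sym _ _) eq

  -- The vertices are listed in the numbering of `PA 7 5`: `w` takes place 0 and carries the pendent
  -- vertices `p` and `q` at places 5 and 6.
  pineapple : ∀ {k w a b c d p q} → AllPairs (Joined k) (w ∷ a ∷ b ∷ c ∷ d ∷ []) →
    All (_≢ p) (w ∷ a ∷ b ∷ c ∷ d ∷ []) → All (_≢ q) (w ∷ a ∷ b ∷ c ∷ d ∷ []) → p ≢ q →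
    χ w p ≡ k → χ w q ≡ k → MonoPineapple
  pineapple {k} {w} {a} {b} {c} {d} {p} {q} clique ≢p ≢q p≢q wp wq = copy , k , mono
    where
    ks = w ∷ a ∷ b ∷ c ∷ d ∷ []
    vs = ks ++ p ∷ q ∷ []

    vs! : Unique vs
    vs! = AllPairs.++⁺ (AllPairs.map proj₁ clique) ((p≢q ∷ []) ∷ [] ∷ [])
      (All.zipWith (λ (x≢p , x≢q) → x≢p ∷ x≢q ∷ []) (≢p , ≢q))

    copy : Copy (PA 7 5) (K n)
    copy = record
      { vertex    = lookup vs
      ; injective = lookup-injective vs!
      ; edge      = λ {u} {v} uv eq → adj-irrefl (PA 7 5) (lookup-injective vs! {u} {v} eq) uv
      }

    clique-index : ∀ (u : Fin 7) → toℕ u < 5 → ∃ λ (i : Fin 5) → toℕ u ≡ toℕ i × lookup vs u ≡ lookup ks i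
    clique-index 0F _ = 0F , refl , refl
    clique-index 1F _ = 1F , refl , refl
    clique-index 2F _ = 2F , refl , refl
    clique-index 3F _ = 3F , refl , refl
    clique-index 4F _ = 4F , refl , refl
    clique-index 5F lt = contradiction lt (<-irrefl refl)
    clique-index 6F lt = contradiction lt (<⇒≯ ≤-refl)

    pendent : ∀ (u v : Fin 7) → toℕ u ≡ 0 → 5 ≤ toℕ v → χ (lookup vs u) (lookup vs v) ≡ k
    pendent 0F 5F _ _ = wp
    pendent 0F 6F _ _ = wq
    pendent 0F 0F _ ()
    pendent 0F 1F _ (s≤s ())
    pendent 0F 2F _ (s≤s (s≤s ()))
    pendent 0F 3F _ (s≤s (s≤s (s≤s ())))
    pendent 0F 4F _ (s≤s (s≤s (s≤s (s≤s ()))))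

    mono : ∀ {u v} → Adj (PA 7 5) u v → edgeColor col copy u v ≡ k
    mono {u} {v} (_ , inj₂ (inj₁ (u≡0 , 5≤v))) = pendent u v u≡0 5≤v
    mono {u} {v} (_ , inj₂ (inj₂ (v≡0 , 5≤u))) = trans (χ-sym _ _) (pendent v u v≡0 5≤u)
    mono {u} {v} (u≢v , inj₁ (u<5 , v<5)) with clique-index u u<5 | clique-index v v<5
    ... | i , u≡i , eqᵤ | j , v≡j , eqᵥ = trans (cong₂ χ eqᵤ eqᵥ)
      (proj₂ (lookup-pairs Joined-sym clique i j (λ { refl → u≢v (toℕ-injective (trans u≡i (sym v≡j))) })))

  monoClique₇ : ∀ {k xs} → length xs ≡ 7 → AllPairs (Joined k) xs → MonoPineapple
  monoClique₇ {xs = w ∷ a ∷ b ∷ c ∷ d ∷ p ∷ q ∷ []} refl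
    ((wa ∷ wb ∷ wc ∷ wd ∷ wp ∷ wq ∷ []) ∷ (ab ∷ ac ∷ ad ∷ ap ∷ aq ∷ []) ∷ (bc ∷ bd ∷ bp ∷ bq ∷ [])
      ∷ (cd ∷ cp ∷ cq ∷ []) ∷ (dp ∷ dq ∷ []) ∷ (pq ∷ []) ∷ _) =
    pineapple ((wa ∷ wb ∷ wc ∷ wd ∷ []) ∷ (ab ∷ ac ∷ ad ∷ []) ∷ (bc ∷ bd ∷ []) ∷ (cd ∷ []) ∷ [] ∷ [])
      (proj₁ wp ∷ proj₁ ap ∷ proj₁ bp ∷ proj₁ cp ∷ proj₁ dp ∷ [])
      (proj₁ wq ∷ proj₁ aq ∷ proj₁ bq ∷ proj₁ cq ∷ proj₁ dq ∷ [])
      (proj₁ pq) (proj₂ wp) (proj₂ wq)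

  monoClique : ∀ {k xs} → 7 ≤ length xs → AllPairs (Joined k) xs → MonoPineapple
  monoClique {xs = xs} 7≤ clique =
    monoClique₇ (trans (length-take 7 xs) (m≤n⇒m⊓n≡m 7≤)) (AllPairs.take⁺ 7 clique)

  others : List (Fin n) → List (Fin n)
  others ss = removeAll _≟_ ss (allFin n)

  others! : ∀ ss → Unique (others ss)
  others! ss = removeAll-! _≟_ ss (Unique.allFin⁺ n)

  length-others : ∀ ss {m} → length ss + m ≤ 26 → m ≤ length (others ss)
  length-others ss {m} le = +-cancelˡ-≤ (length ss) m _ (≤-trans le (≤-trans 26≤n
    (≤-trans (≤-reflexive (sym (length-tabulate id))) (length-removeAll _≟_ ss (Unique.allFin⁺ n)))))

  others⁻ : ∀ ss {x} → x ∈ others ss → All (_≢ x) ss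
  others⁻ ss = proj₂ ∘ removeAll⁻ _≟_ ss

  -- Edges with a common end have equal colors, so every edge can be compared with one fixed edge
  -- `s` `t` through an edge at `s`.
  constant-clique : ∀ {xs} → Unique xs → 7 ≤ length xs →
    (∀ {p q r} → p ∈ xs → q ∈ xs → r ∈ xs → Unique (p ∷ q ∷ r ∷ []) → χ p q ≡ χ p r) → MonoPineapple
  constant-clique {xs} xs! 7≤ const with pick₂ xs! (≤-trans (s≤s (s≤s z≤n)) 7≤)
  ... | s , t , s∈ , t∈ , s≢t = monoClique 7≤ (AllPairs-tabulate xs! λ x∈ y∈ x≢y → x≢y , all≡ x∈ y∈ x≢y)
    where
    from-s : ∀ {y} → y ∈ xs → s ≢ y → χ s y ≡ χ s t
    from-s {y} y∈ s≢y with y ≟ t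
    ... | yes refl = refl
    ... | no y≢t   = const s∈ y∈ t∈ ((s≢y ∷ s≢t ∷ []) ∷ (y≢t ∷ []) ∷ [] ∷ [])
    all≡ : ∀ {x y} → x ∈ xs → y ∈ xs → x ≢ y → χ x y ≡ χ s t
    all≡ {x} {y} x∈ y∈ x≢y with x ≟ s | y ≟ s
    ... | yes refl | _ = from-s y∈ x≢y
    ... | no x≢s | yes refl = trans (χ-sym _ _) (from-s x∈ (≢-sym x≢s))
    ... | no x≢s | no y≢s = trans (const x∈ y∈ s∈ ((x≢y ∷ x≢s ∷ []) ∷ (y≢s ∷ []) ∷ [] ∷ []))
      (trans (χ-sym _ _) (from-s x∈ (≢-sym x≢s)))

  -- Some vertex is incident with three colors.

  Claw : Fin n → Fin n → Fin n → Fin n → Set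
  Claw v a b c = All (v ≢_) (a ∷ b ∷ c ∷ []) × Unique (χ v a ∷ χ v b ∷ χ v c ∷ [])

  claw⇒pineapple : RainbowFree χ → ∀ {v a b c} → Claw v a b c → MonoPineapple
  claw⇒pineapple free {v} {a} {b} {c} (v∉ , ks!@((ab ∷ ac ∷ []) ∷ (bc ∷ []) ∷ _))
    with fresh (χ v a ∷ χ v b ∷ χ v c ∷ []) ≤-refl
  ... | l , l∉ with exact col l
  -- The set `S` has 6 vertices and 7 more are wanted: 6 + 7 = 13 ≤ 13 + 13.
  ...   | x , y , x≢y , refl = constant-clique (others! S) (length-others S (m≤m+n 13 13)) λ p∈ q∈ r∈ pqr! →
      let p∉ = others⁻ S p∈ ; q∉ = others⁻ S q∈ ; r∉ = others⁻ S r∈ in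
      Claws.claw-const _≟_ χ χ-sym free (AllPairs.++⁺ vabc! pqr! (All.take⁺ 4 (zip₃ p∉ q∉ r∉))) (l∉ ∷ ks!) x≢y
        (All.head (All.drop⁺ 4 (zip₃ p∉ q∉ r∉))) (All.head (All.drop⁺ 5 (zip₃ p∉ q∉ r∉)))
    where
    S = v ∷ a ∷ b ∷ c ∷ x ∷ y ∷ []
    vabc! : Unique (v ∷ a ∷ b ∷ c ∷ [])
    vabc! = v∉ ∷ ((ab ∘ cong (χ v)) ∷ (ac ∘ cong (χ v)) ∷ []) ∷ ((bc ∘ cong (χ v)) ∷ []) ∷ [] ∷ []
    zip₃ : ∀ {xs : List (Fin n)} {p q r} → All (_≢ p) xs → All (_≢ q) xs → All (_≢ r) xs →
      All (λ z → All (z ≢_) (p ∷ q ∷ r ∷ [])) xs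
    zip₃ [] [] [] = []
    zip₃ (p ∷ ps) (q ∷ qs) (r ∷ rs) = (p ∷ q ∷ r ∷ []) ∷ zip₃ ps qs rs

  Sees : Fin n → Fin 4 → Set
  Sees v k = ∃ λ a → v ≢ a × χ v a ≡ k

  sees? : ∀ v k → Dec (Sees v k)
  sees? v k = any? (λ a → ¬? (v ≟ a) ×-dec (χ v a ≟ k))

  claw? : Dec (∃₂ λ v a → ∃₂ λ b c → Claw v a b c)
  claw? = any? λ v → any? λ a → any? λ b → any? λ c →
    All.all? (λ x → ¬? (v ≟ x)) (a ∷ b ∷ c ∷ []) ×-dec DecUnique.unique? _≟_ (χ v a ∷ χ v b ∷ χ v c ∷ [])

  -- Every vertex is incident with at most two colors.

  module ClawFree (clawfree : ∀ {v a b c} → ¬ Claw v a b c) where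

    sees-two : ∀ {v i j k} → Sees v i → Sees v j → Sees v k → i ≢ j → k ≡ i ⊎ k ≡ j
    sees-two {i = i} {j} {k} (_ , va , refl) (_ , vb , refl) (_ , vc , refl) i≢j with k ≟ i | k ≟ j
    ... | yes k≡i | _ = inj₁ k≡i
    ... | _ | yes k≡j = inj₂ k≡j
    ... | no k≢i | no k≢j =
      contradiction (va ∷ vb ∷ vc ∷ [] , (i≢j ∷ ≢-sym k≢i ∷ []) ∷ (≢-sym k≢j ∷ []) ∷ [] ∷ []) clawfree

    -- Both ends see the color of the edge between them.
    shared : ∀ {u w} → u ≢ w → ∃ λ k → Sees u k × Sees w k
    shared {u} {w} u≢w = χ u w , (w , u≢w , refl) , (u , ≢-sym u≢w , χ-sym w u)

    seen-color : ∀ k → ∃ λ v → Sees v k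
    seen-color k with exact col k
    ... | x , y , x≢y , eq = x , y , x≢y , eq

    Spread : Fin 4 → Set
    Spread d = ∀ v → Sees v d

    -- A color set avoiding j is {k,l}, since it meets {j,k} and {j,l}; likewise a color set
    -- containing m contains j. These two would be disjoint.
    spread : ∀ {u w j k l m} → Unique (j ∷ k ∷ l ∷ m ∷ []) → Sees u j → Sees u k → Sees w j → Sees w l → Spread j
    spread {u} {w} {j} {k} {l} {m} ((jk ∷ jl ∷ jm ∷ []) ∷ (kl ∷ km ∷ []) ∷ (lm ∷ []) ∷ _) uj uk wj wl t
      with sees? t j
    ... | yes tj = tj
    ... | no ¬tj = contradiction (shared t≢z) λ where
        (c , tc , zc) → [ (λ { refl → ¬tj tc }) , (λ { refl → ¬tm tc }) ]′ (sees-two zj zm zc jm)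
      where
      differ : ∀ {x y i} → Sees x i → ¬ Sees y i → x ≢ y
      differ xi ¬yi refl = ¬yi xi

      not-third : ∀ {x a b c} → Sees x a → Sees x b → a ≢ b → a ≢ c → b ≢ c → ¬ Sees x c
      not-third xa xb ab ac bc xc = [ ≢-sym ac , ≢-sym bc ]′ (sees-two xa xb xc ab)

      other : ∀ {x y a b} → Sees x a → Sees x b → a ≢ b → x ≢ y → ¬ Sees y a → Sees y b
      other xa xb ab x≢y ¬ya with shared x≢y
      ... | c , xc , yc with sees-two xa xb xc ab
      ...   | inj₁ refl = contradiction yc ¬ya
      ...   | inj₂ refl = yc

      tk = other uj uk jk (differ uj ¬tj) ¬tj
      tl = other wj wl jl (differ wj ¬tj) ¬tj
      ¬tm = not-third tk tl kl km lm
      z = proj₁ (seen-color m)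
      zm : Sees z m
      zm = proj₂ (seen-color m)
      t≢z = ≢-sym (differ zm ¬tm)
      u≢z = ≢-sym (differ zm (not-third uj uk jk jm km))
      w≢z = ≢-sym (differ zm (not-third wj wl jl jm lm))

      zj : Sees z j
      zj with sees? z j
      ... | yes zj = zj
      ... | no ¬zj = contradiction zm (not-third (other uj uk jk u≢z ¬zj) (other wj wl jl w≢z ¬zj) kl km lm)

    -- A vertex seeing 0 and another seeing 1 share a color. If it is 0, the second vertex sees two
    -- colors; otherwise the first does.
    two-colors : ∃ λ u → ∃₂ λ j k → j ≢ k × Sees u j × Sees u k
    two-colors with seen-color 0F | seen-color 1F
    ... | x , x0 | y , y1 with x ≟ y
    ...   | yes refl = x , 0F , 1F , (λ ()) , x0 , y1
    ...   | no x≢y with shared x≢y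
    ...     | c , xc , yc with c ≟ 0F
    ...       | yes refl = y , 0F , 1F , (λ ()) , yc , y1
    ...       | no c≢0 = x , 0F , c , ≢-sym c≢0 , x0 , xc

    -- Take `u` seeing `j` and `k`, and `w` seeing a further color `l`. The color shared by `u` and
    -- `w` is `j` or `k`, and `spread` applies to it.
    ∃-spread : ∃ Spread
    ∃-spread with two-colors
    ... | u , j , k , jk , uj , uk with fresh (j ∷ k ∷ []) (s≤s (s≤s (s≤s z≤n)))
    ...   | l , l≢j ∷ l≢k ∷ [] with fresh (l ∷ j ∷ k ∷ []) ≤-refl | seen-color l
    ...     | m , m≢l ∷ m≢j ∷ m≢k ∷ [] | w , wl with u ≟ w
    ...       | yes refl = contradiction (sees-two uj uk wl jk) [ l≢j , l≢k ]′
    ...       | no u≢w with shared u≢w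
    ...         | c , uc , wc with sees-two uj uk uc jk
    ...           | inj₁ refl = j , spread
      ((jk ∷ ≢-sym l≢j ∷ ≢-sym m≢j ∷ []) ∷ (≢-sym l≢k ∷ ≢-sym m≢k ∷ []) ∷ (≢-sym m≢l ∷ []) ∷ [] ∷ []) uj uk wc wl
    ...           | inj₂ refl = k , spread
      ((≢-sym jk ∷ ≢-sym l≢k ∷ ≢-sym m≢k ∷ []) ∷ (≢-sym l≢j ∷ ≢-sym m≢j ∷ []) ∷ (≢-sym m≢l ∷ []) ∷ [] ∷ []) uk uj wc wl

    -- Vertex classes joined by a color that every vertex sees.

    module Dominated {d : Fin 4} (dom : Spread d) where

      other-color : ∀ {k v a} → d ≢ k → v ≢ a → χ v a ≢ d → Sees v k → χ v a ≡ k
      other-color d≢k v≢a va≢d vk =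
        [ (λ eq → contradiction eq va≢d) , id ]′ (sees-two (dom _) vk (_ , v≢a , refl) d≢k)

      E : Rel (Fin n) _
      E = Joined d

      E? : ∀ x y → Dec (E x y)
      E? x y = ¬? (x ≟ y) ×-dec (χ x y ≟ d)

      open Ramsey _≟_ {E} E? Joined-sym (λ (x≢x , _) → x≢x refl)

      -- Vertices incident with color d only are put into class k₀.
      module Classes {k₀ : Fin 4} (k₀≢d : k₀ ≢ d) where

        class : Fin n → Fin 4
        class v with any? (λ a → ¬? (v ≟ a) ×-dec ¬? (χ v a ≟ d))
        ... | yes (a , _) = χ v a
        ... | no _        = k₀

        class≢d : ∀ v → class v ≢ d
        class≢d v with any? (λ a → ¬? (v ≟ a) ×-dec ¬? (χ v a ≟ d))
        ... | yes (_ , _ , ≢d) = ≢d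
        ... | no _             = k₀≢d

        class-sees : ∀ {v k} → k ≢ d → Sees v k → class v ≡ k
        class-sees {v} k≢d vk@(a , v≢a , eq) with any? (λ a → ¬? (v ≟ a) ×-dec ¬? (χ v a ≟ d))
        ... | yes (_ , v≢b , ≢d) = other-color (≢-sym k≢d) v≢b ≢d vk
        ... | no ¬∃              = contradiction (a , v≢a , λ eq′ → k≢d (trans (sym eq) eq′)) ¬∃

        class-color : ∀ {v a} → v ≢ a → χ v a ≢ d → χ v a ≡ class v
        class-color v≢a ≢d = sym (class-sees ≢d (_ , v≢a , refl))

        -- An edge of a color other than `d` would put both of its ends into the class of that
        -- color.
        cross : ∀ {x y} → class x ≢ class y → E x y
        cross {x} {y} x≁y = x≁y ∘ cong class , decidable-stable (χ x y ≟ d) λ ≢d →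
          x≁y (trans (sym (class-color (x≁y ∘ cong class) ≢d))
            (trans (χ-sym x y) (class-color (≢-sym (x≁y ∘ cong class)) (≢d ∘ trans (χ-sym x y)))))

        W : Fin 4 → List (Fin n)
        W k = filter (λ v → class v ≟ k) (allFin n)

        W! : ∀ k → Unique (W k)
        W! k = Unique.filter⁺ _ (Unique.allFin⁺ n)

        W⁻ : ∀ {k v} → v ∈ W k → class v ≡ k
        W⁻ {k} v∈ = proj₂ (∈-filter⁻ (λ v → class v ≟ k) {xs = allFin n} v∈)

        W-inhabited : ∀ {k} → k ≢ d → ∃ λ v → class v ≡ k
        W-inhabited {k} k≢d = let v , vk = seen-color k in v , class-sees k≢d vk

        independent-color : ∀ {k ys} → All (λ v → class v ≡ k) ys → AllPairs I ys → AllPairs (Joined k) ys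
        independent-color []         []         = []
        independent-color (eq ∷ eqs) (ix ∷ ind) =
          All.map (λ (x≢y , ¬e) → x≢y , trans (class-color x≢y (λ e → ¬e (x≢y , e))) eq) ix
          ∷ independent-color eqs ind

        -- Two of any three further vertices lie both in the class of w or both outside it; in the
        -- first case w′ is the centre of a pineapple, in the second case w.
        join : ∀ {w w′ x y z} → AllPairs E (w ∷ w′ ∷ x ∷ y ∷ z ∷ []) → class w ≢ class w′ → MonoPineapple
        join {w} {w′} {x} {y} {z} clique@((ww′ ∷ wx) ∷ w′x ∷ xyz) w≁w′ =
          [ centre-w′ , centre-w ]′ (≤-split 2 2
            (s≤s (≤-trans (length-others S (m≤m+n 8 18)) (≤-reflexive (length-split class? (others S))))))
          where
          S = w ∷ w′ ∷ x ∷ y ∷ z ∷ []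

          class? : ∀ v → Dec (class v ≡ class w)
          class? v = class v ≟ class w

          ∉S : ∀ {P : Fin n → Set} (P? : ∀ v → Dec (P v)) {p} → p ∈ filter P? (others S) → All (_≢ p) S
          ∉S P? = others⁻ S ∘ proj₁ ∘ ∈-filter⁻ P? {xs = others S}

          flip-head : ∀ {P : Fin n → Set} {u v xs} → All P (u ∷ v ∷ xs) → All P (v ∷ u ∷ xs)
          flip-head (pu ∷ pv ∷ ps) = pv ∷ pu ∷ ps

          centre-w′ : 2 ≤ length (filter class? (others S)) → MonoPineapple
          centre-w′ 2≤ with pick₂ (Unique.filter⁺ class? (others! S)) 2≤
          ... | p , q , p∈ , q∈ , p≢q = pineapple ((Joined-sym ww′ ∷ w′x) ∷ wx ∷ xyz)
            (flip-head (∉S class? p∈)) (flip-head (∉S class? q∈)) p≢q (to-w′ p∈) (to-w′ q∈)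
            where
            to-w′ : ∀ {p} → p ∈ filter class? (others S) → χ w′ p ≡ d
            to-w′ p∈ = proj₂ (cross (λ w′∼p →
              w≁w′ (sym (trans w′∼p (proj₂ (∈-filter⁻ class? {xs = others S} p∈))))))

          centre-w : 2 ≤ length (filter (¬? ∘ class?) (others S)) → MonoPineapple
          centre-w 2≤ with pick₂ (Unique.filter⁺ (¬? ∘ class?) (others! S)) 2≤
          ... | p , q , p∈ , q∈ , p≢q = pineapple clique
            (∉S (¬? ∘ class?) p∈) (∉S (¬? ∘ class?) q∈) p≢q (to-w p∈) (to-w q∈)
            where
            to-w : ∀ {p} → p ∈ filter (¬? ∘ class?) (others S) → χ w p ≡ d
            to-w p∈ = proj₂ (cross (≢-sym (proj₂ (∈-filter⁻ (¬? ∘ class?) {xs = others S} p∈))))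

        -- The triangle and one vertex from each of the other two classes form a K₅ of color `d`.
        join-triangle : ∀ {i j k} → Unique (i ∷ j ∷ k ∷ []) → j ≢ d → k ≢ d → Triangle (W i) → MonoPineapple
        join-triangle {i} {j} {k} ((i≢j ∷ i≢k ∷ []) ∷ (j≢k ∷ []) ∷ _) j≢d k≢d
          (s ∷ t ∷ u ∷ [] , refl , s∈ ∷ t∈ ∷ u∈ ∷ [] , (st ∷ su ∷ []) ∷ (tu ∷ []) ∷ _)
          with W-inhabited j≢d | W-inhabited k≢d
        ... | y , refl | z , refl = join
          ((≁ s∈ i≢j ∷ ≁ s∈ i≢k ∷ st ∷ su ∷ []) ∷ (cross j≢k ∷ Joined-sym (≁ t∈ i≢j) ∷ Joined-sym (≁ u∈ i≢j) ∷ [])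
            ∷ (Joined-sym (≁ t∈ i≢k) ∷ Joined-sym (≁ u∈ i≢k) ∷ []) ∷ (tu ∷ []) ∷ [] ∷ [])
          (λ eq → i≢j (trans (sym (W⁻ s∈)) eq))
          where
          ≁ : ∀ {x y} → x ∈ W i → i ≢ class y → E x y
          ≁ x∈ i≢y = cross (λ eq → i≢y (trans (sym (W⁻ x∈)) eq))

        -- The two edges and one vertex of the third class form a K₅ of color `d`.
        join-edges : ∀ {i j k} → Unique (i ∷ j ∷ k ∷ []) → k ≢ d → Edge (W i) → Edge (W j) → MonoPineapple
        join-edges {i} {j} {k} ((i≢j ∷ i≢k ∷ []) ∷ (j≢k ∷ []) ∷ _) k≢d
          (s , t , s∈ , t∈ , st) (u , v , u∈ , v∈ , uv) with W-inhabited k≢d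
        ... | z , refl = join
          ((ij s∈ u∈ ∷ ≁ s∈ i≢k ∷ st ∷ ij s∈ v∈ ∷ []) ∷ (≁ u∈ j≢k ∷ Joined-sym (ij t∈ u∈) ∷ uv ∷ [])
            ∷ (Joined-sym (≁ t∈ i≢k) ∷ Joined-sym (≁ v∈ j≢k) ∷ []) ∷ (ij t∈ v∈ ∷ []) ∷ [] ∷ [])
          (λ eq → i≢j (trans (sym (W⁻ s∈)) (trans eq (W⁻ u∈))))
          where
          ≁ : ∀ {x l} → x ∈ W l → l ≢ class z → E x z
          ≁ x∈ l≢z = cross (λ eq → l≢z (trans (sym (W⁻ x∈)) eq))
          ij : ∀ {x y} → x ∈ W i → y ∈ W j → E x y
          ij x∈ y∈ = cross (λ eq → i≢j (trans (sym (W⁻ x∈)) (trans eq (W⁻ y∈))))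

        -- A class without edges of color `d` is a clique in its own color.
        edge-or-pineapple : ∀ k → 7 ≤ length (W k) → Edge (W k) ⊎ MonoPineapple
        edge-or-pineapple k 7≤ with edge-or-independent (W! k)
        ... | inj₁ e   = inj₁ e
        ... | inj₂ ind = inj₂ (monoClique 7≤ (independent-color (All.tabulate W⁻) ind))

        -- Without a triangle there is a K₅ of color `k`, and 9 vertices of the class remain. Two of
        -- them joined to `w` in color `k` complete a pineapple. Otherwise 8 are joined to `w` in
        -- color `d`, and these contain an edge of color `d`, giving a triangle with `w`, or form a
        -- clique of color `k`.
        triangle-or-pineapple : ∀ k → 14 ≤ length (W k) → Triangle (W k) ⊎ MonoPineapple
        triangle-or-pineapple k 14≤ with arrows₅ (W! k) 14≤
        ... | inj₁ t = inj₁ t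
        ... | inj₂ (S@(w ∷ a ∷ b ∷ c ∷ e ∷ []) , refl , S⊆@(w∈ ∷ _) , ind) =
          [ many-E , two-I ]′ (≤-split 8 2
            (s≤s (≤-trans 9≤rest (≤-reflexive (length-split (E? w) rest)))))
          where
          rest = removeAll _≟_ S (W k)

          rest! : Unique rest
          rest! = removeAll-! _≟_ S (W! k)

          9≤rest : 9 ≤ length rest
          9≤rest = +-cancelˡ-≤ 5 9 _ (≤-trans 14≤ (length-removeAll _≟_ S (W! k)))

          rest⊆ : ∀ {v} → v ∈ rest → v ∈ W k
          rest⊆ = proj₁ ∘ removeAll⁻ _≟_ S

          many-E : 8 ≤ length (E-nbrs w rest) → Triangle (W k) ⊎ MonoPineapple
          many-E 8≤ with edge-or-independent (Unique.filter⁺ (E? w) rest!)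
          ... | inj₂ ind′ = inj₂ (monoClique (≤-trans (n≤1+n 7) 8≤) (independent-color
                (All.tabulate (W⁻ ∘ rest⊆ ∘ proj₁ ∘ ∈-filter⁻ (E? w))) ind′))
          ... | inj₁ (x , y , x∈ , y∈ , xy)
            with ∈-filter⁻ (E? w) {xs = rest} x∈ | ∈-filter⁻ (E? w) {xs = rest} y∈
          ...   | x∈′ , wx | y∈′ , wy = inj₁ (w ∷ x ∷ y ∷ [] , refl , w∈ ∷ rest⊆ x∈′ ∷ rest⊆ y∈′ ∷ []
                , (wx ∷ wy ∷ []) ∷ (xy ∷ []) ∷ [] ∷ [])

          two-I : 2 ≤ length (filter (¬? ∘ E? w) rest) → Triangle (W k) ⊎ MonoPineapple
          two-I 2≤ with pick₂ (Unique.filter⁺ (¬? ∘ E? w) rest!) 2≤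
          ... | p , q , p∈ , q∈ , p≢q = inj₂ (pineapple (independent-color (All.map W⁻ S⊆) ind)
              (∉S p∈) (∉S q∈) p≢q (to-w p∈) (to-w q∈))
            where
            ∉S : ∀ {p} → p ∈ filter (¬? ∘ E? w) rest → All (_≢ p) S
            ∉S = proj₂ ∘ removeAll⁻ _≟_ S {W k} ∘ proj₁ ∘ ∈-filter⁻ (¬? ∘ E? w) {xs = rest}
            to-w : ∀ {p} → p ∈ filter (¬? ∘ E? w) rest → χ w p ≡ k
            to-w p∈ = trans (class-color w≢p (λ eq → proj₂ (∈-filter⁻ (¬? ∘ E? w) {xs = rest} p∈) (w≢p , eq))) (W⁻ w∈)
              where w≢p = All.head (∉S p∈)

      dominated⇒pineapple : MonoPineapple
      dominated⇒pineapple with fresh (d ∷ []) (s≤s (s≤s z≤n))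
      ... | i , i≢d ∷ [] with fresh (i ∷ d ∷ []) (s≤s (s≤s (s≤s z≤n)))
      ...   | j , j≢i ∷ j≢d ∷ [] with fresh (j ∷ i ∷ d ∷ []) ≤-refl
      ...     | k , k≢j ∷ k≢i ∷ k≢d ∷ [] = go (14 ≤? length (W i)) (14 ≤? length (W j)) (14 ≤? length (W k))
        where
        open Classes i≢d

        ijk! : Unique (i ∷ j ∷ k ∷ [])
        ijk! = (≢-sym j≢i ∷ ≢-sym k≢i ∷ []) ∷ (≢-sym k≢j ∷ []) ∷ [] ∷ []

        jik! : Unique (j ∷ i ∷ k ∷ [])
        jik! = (j≢i ∷ ≢-sym k≢j ∷ []) ∷ (≢-sym k≢i ∷ []) ∷ [] ∷ []

        covered : ∀ v → class v ≡ i ⊎ class v ≡ j ⊎ class v ≡ k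
        covered v with Unique-full ((k≢j ∷ k≢i ∷ k≢d ∷ []) ∷ (j≢i ∷ j≢d ∷ []) ∷ (i≢d ∷ []) ∷ [] ∷ []) refl (class v)
        ... | here eq                         = inj₂ (inj₂ eq)
        ... | there (here eq)                 = inj₂ (inj₁ eq)
        ... | there (there (here eq))         = inj₁ eq
        ... | there (there (there (here eq))) = contradiction eq (class≢d v)

        total : 26 ≤ length (W i) + (length (W j) + length (W k))
        total = ≤-trans 26≤n (≤-trans (≤-reflexive (sym (length-tabulate id)))
          (length-cover (λ v → class v ≟ i) (λ v → class v ≟ j) (λ v → class v ≟ k) covered (allFin n)))

        large : ∀ {i j k} → Unique (i ∷ j ∷ k ∷ []) → j ≢ d → k ≢ d → 14 ≤ length (W i) → MonoPineapple
        large ijk! j≢d k≢d 14≤ = [ join-triangle ijk! j≢d k≢d , id ]′ (triangle-or-pineapple _ 14≤)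

        medium : ∀ {i j k} → Unique (i ∷ j ∷ k ∷ []) → k ≢ d → 7 ≤ length (W i) → 7 ≤ length (W j) → MonoPineapple
        medium {i} {j} ijk! k≢d 7≤ᵢ 7≤ⱼ with edge-or-pineapple i 7≤ᵢ | edge-or-pineapple j 7≤ⱼ
        ... | inj₂ p | _      = p
        ... | _      | inj₂ p = p
        ... | inj₁ e | inj₁ f = join-edges ijk! k≢d e f

        go : Dec (14 ≤ length (W i)) → Dec (14 ≤ length (W j)) → Dec (14 ≤ length (W k)) → MonoPineapple
        go (yes 14≤) _ _ = large ijk! j≢d k≢d 14≤
        go _ (yes 14≤) _ = large jik! i≢d k≢d 14≤
        go _ _ (yes 14≤) = large ((k≢i ∷ k≢j ∷ []) ∷ (≢-sym j≢i ∷ []) ∷ [] ∷ []) i≢d j≢d 14≤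
        -- No class exceeds 13 vertices, so any two have at least 13 together, and one of them has
        -- at least 7. Used for two pairs, this yields two classes with at least 7 vertices.
        go (no i≱) (no j≱) (no k≱) = [ i-medium , j-medium ]′ (≤-split 7 7 (s≤s 13≤wᵢ+wⱼ))
          where
          wᵢ = length (W i)
          wⱼ = length (W j)
          wₖ = length (W k)

          13≤wⱼ+wₖ : 13 ≤ wⱼ + wₖ
          13≤wⱼ+wₖ = +-cancelˡ-≤ 13 13 _ (≤-trans total (+-monoˡ-≤ (wⱼ + wₖ) (s≤s⁻¹ (≰⇒> i≱))))

          13≤wᵢ+wₖ : 13 ≤ wᵢ + wₖ
          13≤wᵢ+wₖ = +-cancelˡ-≤ 13 13 _ (≤-trans total (≤-trans (≤-reflexive (x∙yz≈y∙xz wᵢ wⱼ wₖ))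
            (+-monoˡ-≤ (wᵢ + wₖ) (s≤s⁻¹ (≰⇒> j≱)))))

          13≤wᵢ+wⱼ : 13 ≤ wᵢ + wⱼ
          13≤wᵢ+wⱼ = +-cancelʳ-≤ 13 13 _ (≤-trans total (≤-trans (≤-reflexive (sym (+-assoc wᵢ wⱼ wₖ)))
            (+-monoʳ-≤ (wᵢ + wⱼ) (s≤s⁻¹ (≰⇒> k≱)))))

          i-medium : 7 ≤ wᵢ → MonoPineapple
          i-medium 7≤wᵢ = [ medium ijk! k≢d 7≤wᵢ
            , medium ((≢-sym k≢i ∷ ≢-sym j≢i ∷ []) ∷ (k≢j ∷ []) ∷ [] ∷ []) j≢d 7≤wᵢ ]′ (≤-split 7 7 (s≤s 13≤wⱼ+wₖ))

          j-medium : 7 ≤ wⱼ → MonoPineapple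
          j-medium 7≤wⱼ = [ (λ 7≤wᵢ → medium ijk! k≢d 7≤wᵢ 7≤wⱼ)
            , medium ((≢-sym k≢j ∷ j≢i ∷ []) ∷ (k≢i ∷ []) ∷ [] ∷ []) i≢d 7≤wⱼ ]′ (≤-split 7 7 (s≤s 13≤wᵢ+wₖ))

  rainbow-or-mono : Σ (Copy (P 5) (K n)) (Rainbow col) ⊎ MonoPineapple
  rainbow-or-mono with rainbow?
    where
    rainbow? : Dec (∃₂ λ a b → ∃₂ λ c d → ∃ λ e →
      Unique (a ∷ b ∷ c ∷ d ∷ e ∷ []) × Unique (χ a b ∷ χ b c ∷ χ c d ∷ χ d e ∷ []))
    rainbow? = any? λ a → any? λ b → any? λ c → any? λ d → any? λ e →
      DecUnique.unique? _≟_ (a ∷ b ∷ c ∷ d ∷ e ∷ []) ×-dec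
      DecUnique.unique? _≟_ (χ a b ∷ χ b c ∷ χ c d ∷ χ d e ∷ [])
  ... | yes (_ , _ , _ , _ , _ , vs! , cs!) = inj₁ (rainbowPath vs! cs!)
  ... | no ¬rainbow with claw?
  ...   | yes (_ , _ , _ , _ , claw) =
    inj₂ (claw⇒pineapple (λ vs! cs! → ¬rainbow (_ , _ , _ , _ , _ , vs! , cs!)) claw)
  ...   | no ¬claw = inj₂ (Dominated.dominated⇒pineapple (proj₂ ∃-spread))
    where open ClawFree (λ claw → ¬claw (_ , _ , _ , _ , claw))

-- The lower bound: a coloring of K₂₅.

module Lower where

  block : Fin 25 → Fin 3
  block v = if toℕ v <ᵇ 13 then 0F else if toℕ v <ᵇ 19 then 1F else 2F

  -- The differences 1, 5, 8, 12 are the nonzero cubes modulo 13; this circulant graph on the block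
  -- of 13 vertices is the Ramsey graph for R(3,5).
  cubic : ℕ → Bool
  cubic m = (m ≡ᵇ 1) ∨ (m ≡ᵇ 5) ∨ (m ≡ᵇ 8) ∨ (m ≡ᵇ 12)

  blockColor : Fin 3 → Fin 3 → ℕ → Fin 4
  blockColor 0F 0F m = if cubic m then 0F else 1F
  blockColor 1F 1F _ = 2F
  blockColor 2F 2F _ = 3F
  blockColor _  _  _ = 0F

  χ : Fin 25 → Fin 25 → Fin 4
  χ u v = blockColor (block u) (block v) ∣ toℕ u - toℕ v ∣

  col : ExactColoring (K 25) 4
  col = record
    { color     = χ
    ; color-sym = from-yes (all? λ i → all? λ j → χ i j ≟ χ j i)
    ; exact     = λ where
        -- An edge between blocks, a non-cubic difference in the block of 13, and an edge in each
        -- small block.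
        0F → # 0 , # 13 , (λ ()) , refl
        1F → # 0 , # 2 , (λ ()) , refl
        2F → # 13 , # 14 , (λ ()) , refl
        3F → # 19 , # 20 , (λ ()) , refl
    }

  module _ (k : Fin 4) where

    Edge : Rel (Fin 25) _
    Edge u v = u ≢ v × χ u v ≡ k

    edge? : ∀ u v → Dec (Edge u v)
    edge? u v = ¬? (u ≟ v) ×-dec χ u v ≟ k

    -- Passing to neighbourhoods makes the decision procedure follow only sequences of mutually
    -- joined vertices instead of all subsets. The base case is false since the empty clique always
    -- exists.
    CliqueFree : ℕ → List (Fin 25) → Set
    CliqueFree 0       vs = ⊥
    CliqueFree (suc m) vs = All (λ v → CliqueFree m (filter (edge? v) vs)) vs

    cliqueFree? : ∀ m vs → Dec (CliqueFree m vs)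
    cliqueFree? 0       vs = no λ ()
    cliqueFree? (suc m) vs = All.all? (λ v → cliqueFree? m (filter (edge? v) vs)) vs

    clique-free : ∀ {vs us} → CliqueFree (length us) vs → All (_∈ vs) us → AllPairs Edge us → ⊥
    clique-free {us = []}    ()   _          _
    clique-free {us = u ∷ _} free (u∈ ∷ us⊆) (edges ∷ clique) = clique-free (All.lookup free u∈)
      (All.zipWith (λ (v∈ , e) → ∈-filter⁺ (edge? u) v∈ e) (us⊆ , edges)) clique

    module _ (f : Copy (PA 7 5) (K 25)) (mono : ∀ {u v} → Adj (PA 7 5) u v → edgeColor col f u v ≡ k) where

      edge-image : ∀ {u v} → Adj (PA 7 5) u v → Edge (vertex f u) (vertex f v)
      edge-image uv = edge f uv , mono uv

      no-clique : CliqueFree 5 (allFin 25) → ⊥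
      no-clique free = clique-free free (All.tabulate λ _ → ∈-allFin _) (AllPairs.map⁺ (AllPairs.map edge-image
        (from-yes (AllPairs.allPairs? (adj? (PA 7 5)) (0F ∷ 1F ∷ 2F ∷ 3F ∷ 4F ∷ [])))))

      large-degree : 6 ≤ length (filter (edge? (vertex f 0F)) (allFin 25))
      large-degree = length-⊆ (Unique.map⁺ (injective f) leaves!)
        (All.map⁺ (All.map (λ e → ∈-filter⁺ (edge? (vertex f 0F)) (∈-allFin _) (edge-image e))
          (from-yes (All.all? (adj? (PA 7 5) 0F) leaves))))
        where
        leaves : List (Fin 7)
        leaves = 1F ∷ 2F ∷ 3F ∷ 4F ∷ 5F ∷ 6F ∷ []
        leaves! : Unique leaves
        leaves! = from-yes (DecUnique.unique? _≟_ leaves)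

  -- Color 0 has cliques of size at most 2 + 1 + 1, as the cubic graph is triangle-free; color 1 has
  -- none of size 5, as that graph has no 5 independent vertices. Colors 2 and 3 form copies of K₆,
  -- of degree 5, whereas vertex 0 of the pineapple has degree 6.
  no-mono : ∀ f → ¬ Monochromatic {G = PA 7 5} col f
  no-mono f (0F , mono) = no-clique 0F f mono (from-yes (cliqueFree? 0F 5 (allFin 25)))
  no-mono f (1F , mono) = no-clique 1F f mono (from-yes (cliqueFree? 1F 5 (allFin 25)))
  no-mono f (2F , mono) = contradiction (large-degree 2F f mono)
    (from-yes (all? λ u → ¬? (6 ≤? length (filter (edge? 2F u) (allFin 25)))) (vertex f 0F))
  no-mono f (3F , mono) = contradiction (large-degree 3F f mono)
    (from-yes (all? λ u → ¬? (6 ≤? length (filter (edge? 3F u) (allFin 25)))) (vertex f 0F))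

  blockColor-zero-or : ∀ b b′ m → blockColor b b′ m ≡ 0F ⊎ blockColor b b′ m ≡ suc b × b ≡ b′
  blockColor-zero-or 0F 0F m with cubic m
  ... | true  = inj₁ refl
  ... | false = inj₂ (refl , refl)
  blockColor-zero-or 0F 1F _ = inj₁ refl
  blockColor-zero-or 0F 2F _ = inj₁ refl
  blockColor-zero-or 1F 0F _ = inj₁ refl
  blockColor-zero-or 1F 1F _ = inj₂ (refl , refl)
  blockColor-zero-or 1F 2F _ = inj₁ refl
  blockColor-zero-or 2F 0F _ = inj₁ refl
  blockColor-zero-or 2F 1F _ = inj₁ refl
  blockColor-zero-or 2F 2F _ = inj₂ (refl , refl)

  χ-block : ∀ u v → χ u v ≡ 0F ⊎ χ u v ≡ suc (block u) × block u ≡ block v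
  χ-block u v = blockColor-zero-or (block u) (block v) ∣ toℕ u - toℕ v ∣

  -- A nonzero color determines its block, so two nonzero edges at `v` both have the color of the
  -- block of `v`.
  consecutive : ∀ u v w → χ u v ≢ χ v w → χ u v ≡ 0F ⊎ χ v w ≡ 0F
  consecutive u v w ≢ with χ-block u v | χ-block v w
  ... | inj₁ z        | _              = inj₁ z
  ... | _             | inj₁ z         = inj₂ z
  ... | inj₂ (p , eq) | inj₂ (q , _)   = contradiction (trans p (trans (cong suc eq) (sym q))) ≢

  -- Color 0 occurs among the first two edges and again among the last two.
  no-rainbow : ∀ f → ¬ Rainbow {G = P 5} col f
  no-rainbow f rainbow = [ (λ p → [ clash 0F 2F (λ ()) p , clash 0F 3F (λ ()) p ]′ two-three)
                         , (λ p → [ clash 1F 2F (λ ()) p , clash 1F 3F (λ ()) p ]′ two-three) ]′ zero-one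
    where
    pathColor : Fin 4 → Fin 4
    pathColor i = χ (vertex f (inject₁ i)) (vertex f (suc i))

    distinct : ∀ i j → i ≢ j → pathColor i ≢ pathColor j
    distinct i j i≢j eq with rainbow (step i) (step j) eq
      where
      step : ∀ i → Adj (P 5) (inject₁ i) (suc i)
      step i = inj₁ (cong suc (sym (toℕ-inject₁ i)))
    ... | inj₁ (_ , eq′)      = i≢j (Fin.suc-injective eq′)
    -- Opposite orientations would give i = j + 1 and i + 1 = j, hence j = j + 2.
    ... | inj₂ (i≡1+j , 1+i≡j) = ℕ.m≢1+m+n (toℕ j) {1} (trans (sym (toℕ-inject₁ j))
      (trans (sym (cong toℕ 1+i≡j)) (trans (cong suc (trans (sym (toℕ-inject₁ i)) (cong toℕ i≡1+j)))
        (cong suc (ℕ.+-comm 1 (toℕ j))))))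

    clash : ∀ i j → i ≢ j → pathColor i ≡ 0F → pathColor j ≡ 0F → ⊥
    clash i j i≢j p q = distinct i j i≢j (trans p (sym q))

    zero-one : pathColor 0F ≡ 0F ⊎ pathColor 1F ≡ 0F
    zero-one = consecutive (vertex f 0F) (vertex f 1F) (vertex f 2F) (distinct 0F 1F λ ())

    two-three : pathColor 2F ≡ 0F ⊎ pathColor 3F ≡ 0F
    two-three = consecutive (vertex f 2F) (vertex f 3F) (vertex f 4F) (distinct 2F 3F λ ())

theorem4p4 : IsGallaiRamseyNumber 4 (P 5) (PA 7 5) 26
-- 325 is the number of edges of K₂₆.
theorem4p4 = (from-yes (4 ≤? 325) , λ n 26≤n col → Upper.rainbow-or-mono 26≤n col) , minimal
  where
  minimal : ∀ M → GallaiRamseyProperty 4 (P 5) (PA 7 5) M → 26 ≤ M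
  -- For M < 26 the property would cover n = 25, where the coloring `Lower.col` refutes it.
  minimal M (_ , property) = ≮⇒≥ λ M<26 → [ (λ (f , rainbow) → Lower.no-rainbow f rainbow)
                                          , (λ (f , mono) → Lower.no-mono f mono) ]′
    (property 25 (s≤s⁻¹ M<26) Lower.col)
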